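{- Fix $a,b,c\in\{0,1\}$. $\beta$-reduction $\to$ on $abc$-infinitary $\lambda$-terms satisfies property $Q$: for every ordinal $\delta$ and all $abc$-infinitary $\lambda$-terms $s,t,t'$, if $P_\delta$ holds and $s\twoheadrightarrow_\delta t\to t'$, then there is a term $s'$ with $s\to^*s'\twoheadrightarrow_\delta t'$.
   Context: Fix $a,b,c\in\{0,1\}$ and a countable set of variables. $abc$-infinitary $\lambda$-terms are possibly infinite terms generated by $x\mid\lambda x.s\mid st$ in which every infinite branch passes infinitely often through a coinductive position (the body of an abstraction is coinductive iff $a=1$, the function part of an application iff $b=1$, the argument iff $c=1$), taken modulo $\alpha$-equivalence; $s[t/x]$ is capture-avoiding substitution. $\beta$-reduction $\to$ is defined inductively: $(\lambda x.s)t\to s[t/x]$; if $u\to u'$ then $\lambda x.u\to\lambda x.u'$ and $uv\to u'v$; if $v\to v'$ then $uv\to uv'$. $\to^*$ is its reflexive transitive closure. For every ordinal $\gamma$ (by well-founded induction), relations $\twoheadrightarrow_\gamma$, $\overline{\twoheadrightarrow}_\gamma$ are defined by: (split) $s\twoheadrightarrow_\gamma t$ if there are $m\in\mathbb N$, $s'$ with $s\rightsquigarrow^\gamma_ms'$ and $s'\,\overline{\twoheadrightarrow}_\gamma\,t$, where $s\rightsquigarrow^\gamma_ms'$ means there are ordinals $\delta_1,\dots,\delta_m<\gamma$ and terms with $s\to^*s_1'\,\overline{\twoheadrightarrow}_{\delta_1}\,t_1\to^*\cdots\overline{\twoheadrightarrow}_{\delta_m}\,t_m\to^*s'$ (for $m=0$: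 $s\to^*s'$); (lift$_x$) $x\,\overline{\twoheadrightarrow}_\gamma\,x$; (lift$_\lambda$) $\lambda x.u\,\overline{\twoheadrightarrow}_\gamma\,\lambda x.u'$ if $u\twoheadrightarrow_\gamma u'$ (premiss coinductive iff $a=1$); (lift$_@$) $uv\,\overline{\twoheadrightarrow}_\gamma\,u'v'$ if $u\twoheadrightarrow_\gamma u'$ (coinductive iff $b=1$) and $v\twoheadrightarrow_\gamma v'$ (coinductive iff $c=1$). Derivations may be non-wellfounded provided every infinite branch crosses infinitely many coinductive premisses. Property $P_\delta$: for all $n\in\mathbb N$ and terms $s,s'$, if $s\rightsquigarrow^\delta_ns'$ then there are $s''$ and $\epsilon<\delta$ with $s\to^*s''$ and $s''\,(\overline{\twoheadrightarrow}_\epsilon)^*\,s'$ ($(\cdot)^*$ = reflexive transitive closure). -}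

module Defs where

open import Level using (Level; _⊔_) renaming (suc to lsuc; zero to lzero)
open import Data.Bool using (Bool; true; false; if_then_else_)
open import Data.Nat using (ℕ; zero; suc; _+_; _∸_; _≤_; _<ᵇ_; _≡ᵇ_)
open import Data.List using (List; []; _∷_; _++_; [_])
open import Data.Product using (Σ; _×_; _,_)
open import Relation.Binary.PropositionalEquality using (_≡_; _≢_)

data Dir : Set where
  body fun arg : Dir

data Label : Set where
  var  : ℕ → Label
  lam  : Label
  app  : Label
  none : Label

Tree : Set
Tree = List Dir → Label

_∣_ : Tree → Dir → Tree
(s ∣ d) p = s (d ∷ p)

data HasChild : Label → Dir → Set where
  lam-body : HasChild lam body
  app-fun  : HasChild app fun
  app-arg  : HasChild app arg

prefix : ℕ → (ℕ → Dir) → List Dir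
prefix zero    π = []
prefix (suc n) π = π 0 ∷ prefix n (λ i → π (suc i))

_≈_ : Tree → Tree → Set
s ≈ t = ∀ p → s p ≡ t p

bnd : Dir → ℕ
bnd body = 1
bnd fun  = 0
bnd arg  = 0

shiftAt : ℕ → ℕ → Tree → List Dir → Label
shiftAt c k t []      with t []
... | var m = if m <ᵇ c then var m else var (m + k)
... | l     = l
shiftAt c k t (d ∷ p) = shiftAt (c + bnd d) k (t ∣ d) p

-- label at address p of s[t/k] (k = de Bruijn index of the substituted
-- variable at the current depth; bound variable removed, so indices > k
-- are decremented)
substAt : ℕ → Tree → Tree → List Dir → Label
substAt k s t p = go (s []) p
  where
    other : ℕ → Label
    other n = if n <ᵇ k then var n else var (n ∸ 1)

    go : Label → List Dir → Label
    go (var n) p       = if n ≡ᵇ k then shiftAt 0 k t p else otherAt n p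
      where
        otherAt : ℕ → List Dir → Label
        otherAt n []      = other n
        otherAt n (_ ∷ _) = none
    go l       []      = l
    go l       (d ∷ q) = substAt (k + bnd d) (s ∣ d) t q

_[_]₀ : Tree → Tree → Tree
s [ t ]₀ = substAt 0 s t

module Infinitary (a b c : Bool) where

  flag : Dir → Bool
  flag body = a
  flag fun  = b
  flag arg  = c

  record IsTerm (s : Tree) : Set where
    field
      root     : s [] ≢ none
      closed   : ∀ p d → s (p ++ [ d ]) ≢ none → HasChild (s p) d
      complete : ∀ p d → HasChild (s p) d → s (p ++ [ d ]) ≢ none
      abc      : ∀ (π : ℕ → Dir) → (∀ n → s (prefix n π) ≢ none) →
                 ∀ n → Σ ℕ λ m → n ≤ m × flag (π m) ≡ true

  data _⟶_ : Tree → Tree → Set where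
    β    : ∀ {s u} → s [] ≡ app → (s ∣ fun) [] ≡ lam →
           u ≈ (((s ∣ fun) ∣ body) [ s ∣ arg ]₀) → s ⟶ u
    lamᶜ : ∀ {s s'} → s [] ≡ lam → s' [] ≡ lam →
           (s ∣ body) ⟶ (s' ∣ body) → s ⟶ s'
    appˡ : ∀ {s s'} → s [] ≡ app → s' [] ≡ app →
           (s ∣ fun) ⟶ (s' ∣ fun) → (s ∣ arg) ≈ (s' ∣ arg) → s ⟶ s'
    appʳ : ∀ {s s'} → s [] ≡ app → s' [] ≡ app →
           (s ∣ fun) ≈ (s' ∣ fun) → (s ∣ arg) ⟶ (s' ∣ arg) → s ⟶ s'

  data Star {ℓ : Level} (R : Tree → Tree → Set ℓ) : Tree → Tree → Set ℓ where
    ε   : ∀ {s t} → s ≈ t → Star R s t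
    _◅_ : ∀ {s u t} → R s u → IsTerm u → Star R u t → Star R s t

  _⟶*_ : Tree → Tree → Set
  _⟶*_ = Star _⟶_

  module Ordinal {O : Set} (_<_ : O → O → Set) where

    -- one layer of the definition: X interprets the coinductive premisses
    module Layer (X : O → Tree → Tree → Set) where
      mutual
        data Red (γ : O) : Tree → Tree → Set where
          split : ∀ {m s s' t} → IsTerm s' → SeqL γ m s s' → Bar γ s' t →
                  Red γ s t

        data Bar (γ : O) : Tree → Tree → Set where
          liftˣ : ∀ {n s t} → s [] ≡ var n → t [] ≡ var n → Bar γ s t
          liftλ : ∀ {s t} → s [] ≡ lam → t [] ≡ lam →
                  Prem (flag body) γ (s ∣ body) (t ∣ body) → Bar γ s t
          lift· : ∀ {s t} → s [] ≡ app → t [] ≡ app →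
                  Prem (flag fun) γ (s ∣ fun) (t ∣ fun) →
                  Prem (flag arg) γ (s ∣ arg) (t ∣ arg) → Bar γ s t

        data Prem : Bool → O → Tree → Tree → Set where
          ind   : ∀ {γ s t} → Red γ s t → Prem false γ s t
          coind : ∀ {γ s t} → X γ s t → Prem true γ s t

        data SeqL (γ : O) : ℕ → Tree → Tree → Set where
          done : ∀ {s s'} → s ⟶* s' → SeqL γ zero s s'
          step : ∀ {m s s₁ δ t₁ s'} → IsTerm s₁ → IsTerm t₁ →
                 s ⟶* s₁ → δ < γ → Bar δ s₁ t₁ → SeqL γ m t₁ s' →
                 SeqL γ (suc m) s s'

    open Layer

    PostFixed : (O → Tree → Tree → Set) → Set
    PostFixed X = ∀ {γ s t} → X γ s t → Red X γ s t

    _↠[_]_ : Tree → O → Tree → Set₁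
    s ↠[ γ ] t = Σ (O → Tree → Tree → Set) λ X → PostFixed X × X γ s t

    _↠̄[_]_ : Tree → O → Tree → Set₁
    s ↠̄[ γ ] t = Σ (O → Tree → Tree → Set) λ X → PostFixed X × Bar X γ s t

    Seq : O → ℕ → Tree → Tree → Set₁
    Seq γ m s s' = Σ (O → Tree → Tree → Set) λ X → PostFixed X × SeqL X γ m s s'

    P : O → Set₁
    P δ = ∀ (n : ℕ) (s s' : Tree) → IsTerm s → IsTerm s' → Seq δ n s s' →
          Σ Tree λ s'' → Σ O λ ε → IsTerm s'' × (ε < δ) × (s ⟶* s'') ×
            Star (λ x y → x ↠̄[ ε ] y) s'' s'

{-# OPTIONS --safe #-}
-- Take s' = s.  Under P δ, every ⇝-sequence inside a derivation of s ↠[ δ ] t can be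
-- replaced by a finite reduction followed by head-preserving steps, which are pushed
-- into the children; corecursively this yields s ⟶* s₀ ↠̄[ ε ] t for any ε < δ.
-- Appending t ⟶ t' gives s ⇝ t' below δ, and it remains to see t' ↠̄[ δ ] t'.
-- Reflexivity needs every chain of inductive positions of t' to be well-founded, which
-- the classical condition in IsTerm does not provide constructively; for t it is read
-- off the derivation of s ↠[ δ ] t, and it is preserved by β-reduction.
module Submission where

open import Defs
open import Data.Bool using (Bool; true; false)
open import Data.Empty using (⊥; ⊥-elim)
open import Data.List using (List; []; _∷_)
open import Data.Nat using (ℕ; zero; suc; _+_; _≤_; s≤s; _<ᵇ_; _≡ᵇ_)
open import Data.Product using (Σ; Σ-syntax; ∃-syntax; _×_; _,_; proj₁; proj₂)
open import Data.Sum using (_⊎_; inj₁; inj₂)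
open import Induction.WellFounded using (WellFounded)
open import Relation.Binary.Definitions using (Transitive)
open import Relation.Binary.PropositionalEquality
  using (_≡_; _≢_; refl; sym; trans; cong)
open import Relation.Binary.Structures using (IsStrictTotalOrder)
open import Relation.Nullary using (Dec; yes; no; ¬_)

-- Labels, pointwise equality of trees, and substitution.

hasChild? : ∀ l d → Dec (HasChild l d)
hasChild? lam body = yes lam-body
hasChild? app fun  = yes app-fun
hasChild? app arg  = yes app-arg
hasChild? lam fun  = no λ ()
hasChild? lam arg  = no λ ()
hasChild? app body = no λ ()
hasChild? (var _) _ = no λ ()
hasChild? none _   = no λ ()

HasChild-resp : ∀ {l l' d} → l ≡ l' → HasChild l d → HasChild l' d
HasChild-resp refl h = h

hasChild-irr : ∀ {l d} (h h' : HasChild l d) → h ≡ h'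
hasChild-irr lam-body lam-body = refl
hasChild-irr app-fun  app-fun  = refl
hasChild-irr app-arg  app-arg  = refl

≈-refl : ∀ {s} → s ≈ s
≈-refl _ = refl

≈-sym : ∀ {s t} → s ≈ t → t ≈ s
≈-sym e p = sym (e p)

≈-trans : ∀ {s t u} → s ≈ t → t ≈ u → s ≈ u
≈-trans e f p = trans (e p) (f p)

∣-cong : ∀ {s t} → s ≈ t → ∀ d → (s ∣ d) ≈ (t ∣ d)
∣-cong e d p = e (d ∷ p)

shiftAt-cong : ∀ c k {s t} → s ≈ t → shiftAt c k s ≈ shiftAt c k t
shiftAt-cong c k {s} {t} e [] rewrite e [] = refl
shiftAt-cong c k e (d ∷ p) = shiftAt-cong (c + bnd d) k (∣-cong e d) p

substAt-cong : ∀ k {s s' t t'} → s ≈ s' → t ≈ t' → substAt k s t ≈ substAt k s' t'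
substAt-cong k {s} {s'} e f p rewrite e [] with s' []
substAt-cong k e f p | var n with n ≡ᵇ k
substAt-cong k e f p       | var n | true  = shiftAt-cong 0 k f p
substAt-cong k e f []      | var n | false = refl
substAt-cong k e f (_ ∷ _) | var n | false = refl
substAt-cong k e f []      | lam  = refl
substAt-cong k e f (d ∷ p) | lam  = substAt-cong (k + bnd d) (∣-cong e d) f p
substAt-cong k e f []      | app  = refl
substAt-cong k e f (d ∷ p) | app  = substAt-cong (k + bnd d) (∣-cong e d) f p
substAt-cong k e f []      | none = refl
substAt-cong k e f (d ∷ p) | none = substAt-cong (k + bnd d) (∣-cong e d) f p

shiftAt-hasChild : ∀ c k t {d} → HasChild (shiftAt c k t []) d → HasChild (t []) d
shiftAt-hasChild c k t h with t []
... | lam  = h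
... | app  = h
... | none = h
... | var m with m <ᵇ c
shiftAt-hasChild c k t () | var m | true
shiftAt-hasChild c k t () | var m | false

-- Substitution seen from the root, hiding the local helper of `substAt`. Under `miss` fall all
-- leaves other than the substituted variable; of these only the absence of children matters.
data SubstView (k : ℕ) (s t : Tree) : Set where
  hit  : substAt k s t ≈ shiftAt 0 k t → SubstView k s t
  miss : (∀ d → ¬ HasChild (substAt k s t []) d) → SubstView k s t
  node : substAt k s t [] ≡ s [] →
         (∀ d → (substAt k s t ∣ d) ≈ substAt (k + bnd d) (s ∣ d) t) → SubstView k s t

substView : ∀ k s t → SubstView k s t
substView k s t with s [] in eq
... | lam = node (trans (root eq) (sym eq)) (sub eq)
  where
  root : s [] ≡ lam → substAt k s t [] ≡ lam
  root e rewrite e = refl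
  sub : s [] ≡ lam → ∀ d → (substAt k s t ∣ d) ≈ substAt (k + bnd d) (s ∣ d) t
  sub e d p rewrite e = refl
... | app = node (trans (root eq) (sym eq)) (sub eq)
  where
  root : s [] ≡ app → substAt k s t [] ≡ app
  root e rewrite e = refl
  sub : s [] ≡ app → ∀ d → (substAt k s t ∣ d) ≈ substAt (k + bnd d) (s ∣ d) t
  sub e d p rewrite e = refl
... | none = miss (leaf eq)
  where
  leaf : s [] ≡ none → ∀ d → ¬ HasChild (substAt k s t []) d
  leaf e d h rewrite e with h
  ... | ()
... | var n with n ≡ᵇ k in eq'
...   | true  = hit (shifted eq eq')
  where
  shifted : s [] ≡ var n → (n ≡ᵇ k) ≡ true → substAt k s t ≈ shiftAt 0 k t
  shifted e e' p rewrite e | e' = refl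
...   | false = miss (leaf eq eq')
  where
  leaf : s [] ≡ var n → (n ≡ᵇ k) ≡ false → ∀ d → ¬ HasChild (substAt k s t []) d
  leaf e e' d h rewrite e | e' with n <ᵇ k
  leaf e e' d () | true
  leaf e e' d () | false

-- Subterms and finite reduction up to pointwise equality.

module Terms (a b c : Bool) where
  open Infinitary a b c

  ∣-isTerm : ∀ {s d} → IsTerm s → HasChild (s []) d → IsTerm (s ∣ d)
  ∣-isTerm {s} {d} it h = record
    { root     = complete [] d h
    ; closed   = λ p → closed (d ∷ p)
    ; complete = λ p → complete (d ∷ p)
    -- The bound `suc n` excludes the prepended position 0, so the index found can be lowered by
    -- one.
    ; abc      = λ π inf n → unshift (abc (d ◂ π) (infinite inf) (suc n))
    }
    where
    open IsTerm it

    _◂_ : Dir → (ℕ → Dir) → ℕ → Dir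
    (d ◂ π) zero    = d
    (d ◂ π) (suc n) = π n

    infinite : ∀ {π} → (∀ n → (s ∣ d) (prefix n π) ≢ none) →
               ∀ n → s (prefix n (d ◂ π)) ≢ none
    infinite inf zero    = root
    infinite inf (suc n) = inf n

    unshift : ∀ {π n} → (∃[ m ] suc n ≤ m × flag ((d ◂ π) m) ≡ true) →
              ∃[ m ] n ≤ m × flag (π m) ≡ true
    unshift (suc m , s≤s n≤m , e) = m , n≤m , e

  ⟶-respˡ-≈ : ∀ {s s' u} → s ≈ s' → s' ⟶ u → s ⟶ u
  ⟶-respˡ-≈ e (β p q r) =
    β (trans (e []) p) (trans (e _) q)
      (≈-trans r (substAt-cong 0 (λ _ → sym (e _)) (λ _ → sym (e _))))
  ⟶-respˡ-≈ e (lamᶜ p q r) =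
    lamᶜ (trans (e []) p) q (⟶-respˡ-≈ (∣-cong e body) r)
  ⟶-respˡ-≈ e (appˡ p q r f) =
    appˡ (trans (e []) p) q (⟶-respˡ-≈ (∣-cong e fun) r) (≈-trans (∣-cong e arg) f)
  ⟶-respˡ-≈ e (appʳ p q f r) =
    appʳ (trans (e []) p) q (≈-trans (∣-cong e fun) f) (⟶-respˡ-≈ (∣-cong e arg) r)

  ⟶*-respˡ-≈ : ∀ {s s' u} → s ≈ s' → s' ⟶* u → s ⟶* u
  ⟶*-respˡ-≈ e (ε f)        = ε (≈-trans e f)
  ⟶*-respˡ-≈ e ((r ◅ it) rs) = (⟶-respˡ-≈ e r ◅ it) rs

  ⟶*-trans : ∀ {s t u} → s ⟶* t → t ⟶* u → s ⟶* u
  ⟶*-trans (ε e)         q = ⟶*-respˡ-≈ e q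
  ⟶*-trans ((r ◅ it) p) q = (r ◅ it) (⟶*-trans p q)

  -- Well-foundedness of inductive chains and its preservation.

  -- Every chain of inductive positions starting at the root is finite.
  data Founded (t : Tree) : Set where
    founded : (∀ d → HasChild (t []) d → flag d ≡ false → Founded (t ∣ d)) → Founded t

  FoundedAt : Tree → List Dir → Set
  FoundedAt t []      = Founded t
  FoundedAt t (d ∷ p) = HasChild (t []) d → FoundedAt (t ∣ d) p

  -- The inductive counterpart of the field `abc`: every subterm is `Founded`. Addresses outside the
  -- tree count vacuously, by the guard in `FoundedAt`.
  Fair : Tree → Set
  Fair t = ∀ p → FoundedAt t p

  ∣-fair : ∀ {t d} → Fair t → HasChild (t []) d → Fair (t ∣ d)
  ∣-fair f h p = f (_ ∷ p) h

  fair-node : ∀ {t} → (∀ d → HasChild (t []) d → Fair (t ∣ d)) → Fair t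
  fair-node f []      = founded λ d h _ → f d h []
  fair-node f (d ∷ p) = λ h → f d h p

  founded-resp-≈ : ∀ {s t} → s ≈ t → Founded s → Founded t
  founded-resp-≈ e (founded f) = founded λ d h fl →
    founded-resp-≈ (∣-cong e d) (f d (HasChild-resp (sym (e [])) h) fl)

  foundedAt-resp-≈ : ∀ {s t} → s ≈ t → ∀ p → FoundedAt s p → FoundedAt t p
  foundedAt-resp-≈ e []      f = founded-resp-≈ e f
  foundedAt-resp-≈ e (d ∷ p) f = λ h →
    foundedAt-resp-≈ (∣-cong e d) p (f (HasChild-resp (sym (e [])) h))

  fair-resp-≈ : ∀ {s t} → s ≈ t → Fair s → Fair t
  fair-resp-≈ e f p = foundedAt-resp-≈ e p (f p)

  shiftAt-founded : ∀ c k {t} → Founded t → Founded (shiftAt c k t)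
  shiftAt-founded c k {t} (founded f) = founded λ d h fl →
    shiftAt-founded (c + bnd d) k (f d (shiftAt-hasChild c k t h) fl)

  shiftAt-foundedAt : ∀ c k t p → FoundedAt t p → FoundedAt (shiftAt c k t) p
  shiftAt-foundedAt c k t []      f = shiftAt-founded c k f
  shiftAt-foundedAt c k t (d ∷ p) f = λ h →
    shiftAt-foundedAt (c + bnd d) k (t ∣ d) p (f (shiftAt-hasChild c k t h))

  shiftAt-fair : ∀ c k {t} → Fair t → Fair (shiftAt c k t)
  shiftAt-fair c k {t} f p = shiftAt-foundedAt c k t p (f p)

  -- An inductive chain of the result either stays in `s` or enters, after finitely many steps, a
  -- shifted copy of `t`, where it is finite as well.
  substAt-founded : ∀ k {s t} → Founded s → Fair t → Founded (substAt k s t)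
  substAt-founded k {s} {t} (founded f) g with substView k s t
  ... | hit e    = founded-resp-≈ (≈-sym e) (shiftAt-fair 0 k g [])
  ... | miss l   = founded λ d h _ → ⊥-elim (l d h)
  ... | node r e = founded λ d h fl → founded-resp-≈ (≈-sym (e d))
    (substAt-founded (k + bnd d) (f d (HasChild-resp r h) fl) g)

  substAt-foundedAt : ∀ k s {t} p → Fair s → Fair t → FoundedAt (substAt k s t) p
  substAt-foundedAt k s     []      f g = substAt-founded k (f []) g
  substAt-foundedAt k s {t} (d ∷ p) f g with substView k s t
  ... | hit e    = fair-resp-≈ (≈-sym e) (shiftAt-fair 0 k g) (d ∷ p)
  ... | miss l   = λ h → ⊥-elim (l d h)
  ... | node r e = λ h → foundedAt-resp-≈ (≈-sym (e d)) p
    (substAt-foundedAt (k + bnd d) (s ∣ d) p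
      (∣-fair f (HasChild-resp r h)) g)

  -- At the redex, body and argument are fair subterms and substitution preserves fairness; above
  -- it, `fair-node` reassembles the term from its children.
  ⟶-fair : ∀ {t t'} → t ⟶ t' → Fair t → Fair t'
  ⟶-fair {t} (β p q e) f = fair-resp-≈ (≈-sym e) λ r →
    substAt-foundedAt 0 ((t ∣ fun) ∣ body) r
      (∣-fair (∣-fair f (HasChild-resp (sym p) app-fun)) (HasChild-resp (sym q) lam-body))
      (∣-fair f (HasChild-resp (sym p) app-arg))
  ⟶-fair {t' = t'} (lamᶜ p q r) f = fair-node λ d h → children (HasChild-resp q h)
    where
    children : ∀ {d} → HasChild lam d → Fair (t' ∣ d)
    children lam-body = ⟶-fair r (∣-fair f (HasChild-resp (sym p) lam-body))
  ⟶-fair {t' = t'} (appˡ p q r e) f = fair-node λ d h → children (HasChild-resp q h)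
    where
    children : ∀ {d} → HasChild app d → Fair (t' ∣ d)
    children app-fun = ⟶-fair r (∣-fair f (HasChild-resp (sym p) app-fun))
    children app-arg = fair-resp-≈ e (∣-fair f (HasChild-resp (sym p) app-arg))
  ⟶-fair {t' = t'} (appʳ p q e r) f = fair-node λ d h → children (HasChild-resp q h)
    where
    children : ∀ {d} → HasChild app d → Fair (t' ∣ d)
    children app-fun = fair-resp-≈ e (∣-fair f (HasChild-resp (sym p) app-fun))
    children app-arg = ⟶-fair r (∣-fair f (HasChild-resp (sym p) app-arg))

-- Monotonicity and composition of derivations and sequences.

module Reductions (a b c : Bool) {O : Set} (_<_ : O → O → Set) (<-trans : Transitive _<_) where
  open Infinitary a b c
  open Ordinal _<_
  open Layer
  open Terms a b c

  Rel : Set₁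
  Rel = O → Tree → Tree → Set

  -- Each derivation brings its own interpretation of the coinductive premisses; monotonicity moves
  -- two of them into a common one.
  module _ {X Y : Rel} (X⊆Y : ∀ {γ s t} → X γ s t → Y γ s t) where
    Red-map  : ∀ {γ s t} → Red X γ s t → Red Y γ s t
    Bar-map  : ∀ {γ s t} → Bar X γ s t → Bar Y γ s t
    Prem-map : ∀ {i γ s t} → Prem X i γ s t → Prem Y i γ s t
    SeqL-map : ∀ {γ m s t} → SeqL X γ m s t → SeqL Y γ m s t
    Red-map (split it q r)          = split it (SeqL-map q) (Bar-map r)
    Bar-map (liftˣ p q)             = liftˣ p q
    Bar-map (liftλ p q r)           = liftλ p q (Prem-map r)
    Bar-map (lift· p q r r')        = lift· p q (Prem-map r) (Prem-map r')
    Prem-map (ind r)                = ind (Red-map r)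
    Prem-map (coind x)              = coind (X⊆Y x)
    SeqL-map (done r)               = done r
    SeqL-map (step i j r lt x q)    = step i j r lt (Bar-map x) (SeqL-map q)

  SeqL-weaken : ∀ {X γ δ m s t} → γ < δ → SeqL X γ m s t → SeqL X δ m s t
  SeqL-weaken γ<δ (done r)            = done r
  SeqL-weaken γ<δ (step i j r lt x q) = step i j r (<-trans lt γ<δ) x (SeqL-weaken γ<δ q)

  SeqL-prepend : ∀ {X γ m s s' t} → s ⟶* s' → SeqL X γ m s' t → SeqL X γ m s t
  SeqL-prepend p (done r)            = done (⟶*-trans p r)
  SeqL-prepend p (step i j r lt x q) = step i j (⟶*-trans p r) lt x q

  SeqL-trans : ∀ {X γ m n s t u} →
               SeqL X γ m s t → SeqL X γ n t u → SeqL X γ (m + n) s u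
  SeqL-trans (done r)            q' = SeqL-prepend r q'
  SeqL-trans (step i j r lt x q) q' = step i j r lt x (SeqL-trans q q')

  -- The union of two post-fixed relations is post-fixed.
  Seq-trans : ∀ {γ m n s t u} → Seq γ m s t → Seq γ n t u → Seq γ (m + n) s u
  Seq-trans (X , pX , q) (Y , pY , q') =
    (λ γ s t → X γ s t ⊎ Y γ s t) ,
    (λ { (inj₁ x) → Red-map inj₁ (pX x) ; (inj₂ y) → Red-map inj₂ (pY y) }) ,
    SeqL-trans (SeqL-map inj₁ q) (SeqL-map inj₂ q')

  -- The sequence opening the derivation only uses ordinals below `γ`, hence below `δ`; its final
  -- lift becomes one more step, at `γ` itself.
  Red⇒SeqL : ∀ {X γ δ s t} → IsTerm t → γ < δ → Red X γ s t → ∃[ m ] SeqL X δ m s t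
  Red⇒SeqL it γ<δ (split is q x) =
    _ , SeqL-trans (SeqL-weaken γ<δ q) (step is it (ε ≈-refl) γ<δ x (done (ε ≈-refl)))

  Prem⇒Red : ∀ {X i γ s t} → PostFixed X → Prem X i γ s t → Red X γ s t
  Prem⇒Red pX (ind r)   = r
  Prem⇒Red pX (coind x) = pX x

  Bar-root : ∀ {X γ s t} → Bar X γ s t → s [] ≡ t []
  Bar-root (liftˣ p q)     = trans p (sym q)
  Bar-root (liftλ p q _)   = trans p (sym q)
  Bar-root (lift· p q _ _) = trans p (sym q)

  Bar-child : ∀ {X γ s t d} → Bar X γ s t → HasChild (s []) d →
              Prem X (flag d) γ (s ∣ d) (t ∣ d)
  Bar-child (liftˣ p q) h with HasChild-resp p h
  ... | ()
  Bar-child (liftλ p q x) h with HasChild-resp p h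
  ... | lam-body = x
  Bar-child (lift· p q x y) h with HasChild-resp p h
  ... | app-fun = x
  ... | app-arg = y

  mkBar : ∀ {X γ s t} → s [] ≢ none → s [] ≡ t [] →
          (∀ d → HasChild (s []) d → Prem X (flag d) γ (s ∣ d) (t ∣ d)) → Bar X γ s t
  mkBar {s = s} {t} ≢none e f with s [] in eq
  ... | var n = liftˣ eq (sym e)
  ... | lam   = liftλ eq (sym e) (f body lam-body)
  ... | app   = lift· eq (sym e) (f fun app-fun) (f arg app-arg)
  ... | none  = ⊥-elim (≢none refl)

  mkPrem : ∀ {X : Rel} {γ s t} i → (i ≡ true → X γ s t) → (i ≡ false → Red X γ s t) →
           Prem X i γ s t
  mkPrem false _ r = ind (r refl)
  mkPrem true  x _ = coind (x refl)

  -- Fairness and reflexivity.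

  Fair-↠̄-refl : ∀ {γ t} → IsTerm t → Fair t → t ↠̄[ γ ] t
  Fair-↠̄-refl it fair =
    X , (λ { (refl , is , f) → split is (done (ε ≈-refl)) (bar is f (f [])) }) ,
    bar it fair (fair [])
    where
    X : Rel
    X γ s t = s ≡ t × IsTerm s × Fair s

    -- Recursion on `Founded` builds the finite inductive part; at a coinductive position the
    -- diagonal `X` takes over, and fairness supplies a fresh `Founded` proof there.
    bar : ∀ {γ s} → IsTerm s → Fair s → Founded s → Bar X γ s s
    bar is f (founded g) = mkBar (IsTerm.root is) refl λ d h →
      mkPrem (flag d) (λ _ → refl , ∣-isTerm is h , ∣-fair f h)
        (λ fl → split (∣-isTerm is h) (done (ε ≈-refl))
                  (bar (∣-isTerm is h) (∣-fair f h) (g d h fl)))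

  module _ {X : Rel} where
    -- Inductive premisses are nested inductively and mirror the inductive positions of `t`.
    Bar-founded : ∀ {γ s t} → Bar X γ s t → Founded t
    Prem-founded : ∀ {i γ s t} → Prem X i γ s t → i ≡ false → Founded t
    Bar-founded {t = t} (liftˣ p q) = founded λ d h _ → children (HasChild-resp q h)
      where
      children : ∀ {n d} → HasChild (var n) d → Founded (t ∣ d)
      children ()
    Bar-founded {t = t} (liftλ p q x) = founded λ d h → children (HasChild-resp q h)
      where
      children : ∀ {d} → HasChild lam d → flag d ≡ false → Founded (t ∣ d)
      children lam-body = Prem-founded x
    Bar-founded {t = t} (lift· p q x y) = founded λ d h → children (HasChild-resp q h)
      where
      children : ∀ {d} → HasChild app d → flag d ≡ false → Founded (t ∣ d)
      children app-fun = Prem-founded x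
      children app-arg = Prem-founded y
    Prem-founded (ind (split _ _ x)) _ = Bar-founded x

    -- The address is followed through the derivation, unfolding coinductive premisses by `pX`.
    Red-fair : PostFixed X → ∀ {γ s t} → Red X γ s t → Fair t
    Red-fair pX (split _ _ x) []      = Bar-founded x
    Red-fair pX (split _ _ x) (d ∷ p) = λ h →
      Red-fair pX (Prem⇒Red pX (Bar-child x (HasChild-resp (sym (Bar-root x)) h))) p

  -- Derivations without sequence steps.

  -- Layers of derivations in which all sequences have length m = 0.
  mutual
    data Layer₀ (X : Tree → Tree → Set₁) (s t : Tree) : Set₁ where
      layer : ∀ {s'} → IsTerm s' → s ⟶* s' → s' [] ≡ t [] →
              (∀ d → HasChild (s' []) d → Premise₀ X (flag d) (s' ∣ d) (t ∣ d)) →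
              Layer₀ X s t

    data Premise₀ (X : Tree → Tree → Set₁) : Bool → Tree → Tree → Set₁ where
      ind   : ∀ {s t} → Layer₀ X s t → Premise₀ X false s t
      coind : ∀ {s t} → X s t → Premise₀ X true s t

  -- A post-fixed X in Set₁ is no witness for ↠, but the positions of one derivation
  -- are enumerated by (reversed) addresses, and these carve out a witness in Set.
  module Small {X : Tree → Tree → Set₁} (pX : ∀ {s t} → X s t → Layer₀ X s t) where

    Position : Set₁
    Position = Σ[ s ∈ Tree ] Σ[ t ∈ Tree ] Layer₀ X s t

    premise : ∀ {i s t} → Premise₀ X i s t → Layer₀ X s t
    premise (ind l)   = l
    premise (coind x) = pX x

    -- Total by convention: a missing child is the position itself.
    child : Position → Dir → Position
    child (s , t , l@(layer {s'} _ _ _ f)) d with hasChild? (s' []) d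
    ... | yes h = _ , _ , premise (f d h)
    ... | no _  = s , t , l

    child-layer : ∀ {s t s' d} (it : IsTerm s') (r : s ⟶* s') (e : s' [] ≡ t [])
                  (f : ∀ d → HasChild (s' []) d → Premise₀ X (flag d) (s' ∣ d) (t ∣ d))
                  (h : HasChild (s' []) d) →
                  child (s , t , layer it r e f) d ≡ (_ , _ , premise (f d h))
    child-layer {s' = s'} {d} it r e f h with hasChild? (s' []) d
    ... | yes h' = cong (λ h → _ , _ , premise (f d h)) (hasChild-irr h' h)
    ... | no ¬h  = ⊥-elim (¬h h)

    module _ (γ : O) (start : Position) where
      at : List Dir → Position
      at []      = start
      at (d ∷ p) = child (at p) d

      Reached : Rel
      Reached γ' s t = γ' ≡ γ × (Σ[ p ∈ List Dir ] proj₁ (at p) ≡ s × proj₁ (proj₂ (at p)) ≡ t)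

      reached : ∀ p {s t l} → at p ≡ (s , t , l) → Reached γ s t
      reached p e = refl , p , cong proj₁ e , cong (λ q → proj₁ (proj₂ q)) e

      LayerBar : Tree → Tree → Set
      LayerBar s t = Σ[ s' ∈ Tree ] IsTerm s' × (s ⟶* s') × Bar Reached γ s' t

      -- The equation on `at p` ties the layer to its address, so that at a coinductive premiss,
      -- where recursion stops, the pair is known to be reached.
      toBar  : ∀ {s t} p (l : Layer₀ X s t) → at p ≡ (s , t , l) → LayerBar s t
      toPrem : ∀ {i s t} p (x : Premise₀ X i s t) → at p ≡ (s , t , premise x) →
               Prem Reached i γ s t
      toBar p (layer it r e f) eq = _ , it , r , mkBar (IsTerm.root it) e λ d h →
        toPrem (d ∷ p) (f d h)
          (trans (cong (λ q → child q d) eq) (child-layer it r e f h))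
      toPrem p (ind l)   eq with toBar p l eq
      ... | _ , it , r , x = ind (split it (done r) x)
      toPrem p (coind x) eq = coind (reached p eq)

      Reached-postFixed : PostFixed Reached
      Reached-postFixed (refl , p , refl , refl) with toBar p (proj₂ (proj₂ (at p))) refl
      ... | _ , it , r , x = split it (done r) x

    -- With no sequence steps, no ordinal is ever compared, so any `γ` serves as the level.
    Layer₀⇒↠̄ : ∀ {s t} γ → Layer₀ X s t →
                Σ[ s' ∈ Tree ] IsTerm s' × (s ⟶* s') × (s' ↠̄[ γ ] t)
    Layer₀⇒↠̄ γ l with toBar γ (_ , _ , l) [] l refl
    ... | s' , it , r , x = s' , it , r , Reached γ _ , Reached-postFixed γ _ , x

  -- Compression of derivations under `P δ`.

  _⇝[_]_ : Tree → O → Tree → Set₁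
  s ⇝[ γ ] t = ∃[ m ] Seq γ m s t

  ≈⇒⇝ : ∀ {γ s t} → s ≈ t → s ⇝[ γ ] t
  ≈⇒⇝ e = 0 , (λ _ _ _ → ⊥) , (λ ()) , done (ε e)

  ⇝-trans : ∀ {γ s t u} → s ⇝[ γ ] t → t ⇝[ γ ] u → s ⇝[ γ ] u
  ⇝-trans (_ , p) (_ , q) = _ , Seq-trans p q

  ↠̄*-root : ∀ {γ s t} → Star (λ x y → x ↠̄[ γ ] y) s t → s [] ≡ t []
  ↠̄*-root (ε e)                   = e []
  ↠̄*-root (((_ , _ , x) ◅ _) xs) = trans (Bar-root x) (↠̄*-root xs)

  -- Every link preserves the root label, so the child exists all along the chain, and each link's
  -- premiss at `γ` is a legitimate piece of a sequence below `δ`.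
  ↠̄*-child : ∀ {γ δ s t d} → γ < δ → Star (λ x y → x ↠̄[ γ ] y) s t →
              HasChild (s []) d → (s ∣ d) ⇝[ δ ] (t ∣ d)
  ↠̄*-child {d = d} γ<δ (ε e) h = ≈⇒⇝ (∣-cong e d)
  ↠̄*-child {d = d} γ<δ (((X , pX , x) ◅ it) xs) h =
    ⇝-trans (_ , X , pX , proj₂ (Red⇒SeqL (∣-isTerm it h') γ<δ (Prem⇒Red pX (Bar-child x h))))
            (↠̄*-child γ<δ xs h')
    where h' = HasChild-resp (Bar-root x) h

  module Compression {δ : O} (Pδ : P δ) {X : Rel} (pX : PostFixed X) where

    -- The corecursion state: a sequence pushed down from above, still to be run before the original
    -- derivation resumes at `r`. It lies in `Set₁` because the sequence carries its own witness.
    Pending : Tree → Tree → Set₁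
    Pending s t = IsTerm s × (Σ[ r ∈ Tree ] (s ⇝[ δ ] r) × X δ r t)

    -- `P δ` trades the sequence for a finite reduction and a chain of lifts, which is postponed to
    -- the children. Recursion is on the original derivation, so inductive premisses terminate and
    -- coinductive ones become `Pending`.
    compress : ∀ {s r t} → IsTerm s → IsTerm r → s ⇝[ δ ] r → Bar X δ r t →
               Layer₀ Pending s t
    compress-child : ∀ {γ s r t d} → IsTerm s → γ < δ → Star (λ x y → x ↠̄[ γ ] y) s r →
                     Bar X δ r t → HasChild (s []) d →
                     Premise₀ Pending (flag d) (s ∣ d) (t ∣ d)
    compress-premise : ∀ {i s r t} → IsTerm s → s ⇝[ δ ] r → Prem X i δ r t →
                       Premise₀ Pending i s t
    compress {s} {r} is ir (n , q) x with Pδ n s r is ir q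
    ... | _ , _ , is' , γ<δ , rs , xs =
      layer is' rs (trans (↠̄*-root xs) (Bar-root x)) λ d → compress-child is' γ<δ xs x
    compress-child is γ<δ xs (liftˣ p _) h with HasChild-resp (trans (↠̄*-root xs) p) h
    ... | ()
    compress-child is γ<δ xs (liftλ p _ x) h with HasChild-resp (trans (↠̄*-root xs) p) h
    ... | lam-body = compress-premise (∣-isTerm is h) (↠̄*-child γ<δ xs h) x
    compress-child is γ<δ xs (lift· p _ x y) h with HasChild-resp (trans (↠̄*-root xs) p) h
    ... | app-fun = compress-premise (∣-isTerm is h) (↠̄*-child γ<δ xs h) x
    ... | app-arg = compress-premise (∣-isTerm is h) (↠̄*-child γ<δ xs h) y
    compress-premise is q (ind (split ir q' x)) =
      -- The sequence inherited from above is joined to the one opening this premiss, and both are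
      -- compressed together.
      ind (compress is ir (⇝-trans q (_ , X , pX , q')) x)
    compress-premise is q (coind x) = coind (is , _ , q , x)

    Pending-postFixed : ∀ {s t} → Pending s t → Layer₀ Pending s t
    Pending-postFixed (is , _ , q , x) with pX x
    ... | split ir q' y = compress is ir (⇝-trans q (_ , X , pX , q')) y

    ↠-compress : ∀ {s t} γ → IsTerm s → X δ s t →
                 Σ[ s' ∈ Tree ] IsTerm s' × (s ⟶* s') × (s' ↠̄[ γ ] t)
    ↠-compress γ is x =
      Small.Layer₀⇒↠̄ Pending-postFixed γ (Pending-postFixed (is , _ , ≈⇒⇝ ≈-refl , x))

  -- Appending the reduction step.

  ⇝-↠̄-trans : ∀ {γ s r t} → IsTerm r → s ⇝[ γ ] r → r ↠̄[ γ ] t → s ↠[ γ ] t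
  ⇝-↠̄-trans {γ} {s} {r} {t} ir (_ , X , pX , q) (Y , pY , y) =
    Z , (λ { (inj₁ (inj₁ x)) → Red-map X⊆Z (pX x)
           ; (inj₁ (inj₂ y)) → Red-map Y⊆Z (pY y)
           ; (inj₂ (refl , refl , refl)) → split ir (SeqL-map X⊆Z q) (Bar-map Y⊆Z y) }) ,
    inj₂ (refl , refl , refl)
    where
    Z : Rel
    -- The relation `↠` asks for membership in a post-fixed relation, so the new root pair is itself
    -- added to the union.
    Z γ' s' t' = (X γ' s' t' ⊎ Y γ' s' t') ⊎ (γ' ≡ γ × s' ≡ s × t' ≡ t)

    X⊆Z : ∀ {γ s t} → X γ s t → Z γ s t
    X⊆Z x = inj₁ (inj₁ x)

    Y⊆Z : ∀ {γ s t} → Y γ s t → Z γ s t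
    Y⊆Z y = inj₁ (inj₂ y)

  ↠-⟶-trans : ∀ {δ s t t'} → P δ → IsTerm s → IsTerm t → IsTerm t' →
               s ↠[ δ ] t → t ⟶ t' → s ↠[ δ ] t'
  -- Applied to the empty sequence from `s` to `s`, `P δ` serves to produce some ordinal `γ` below
  -- `δ`.
  ↠-⟶-trans {s = s} Pδ is it it' (X , pX , x) r with Pδ 0 s s is is (proj₂ (≈⇒⇝ ≈-refl))
  ... | _ , γ , _ , γ<δ , _ with Compression.↠-compress Pδ pX γ is x
  ... | _ , is₀ , rs , Y , pY , y =
    ⇝-↠̄-trans it'
      -- The compressed derivation is a single step at `γ`, and the reduction to `t'` is the finite
      -- tail of the sequence.
      (_ , Y , pY , step is₀ it rs γ<δ y (done ((r ◅ it') (ε ≈-refl))))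
      (Fair-↠̄-refl it' (⟶-fair r (Red-fair pX (pX x))))

theorem3p15 : (a b c : Bool) {O : Set} (_<_ : O → O → Set) →
    IsStrictTotalOrder _≡_ _<_ → WellFounded _<_ →
    let open Infinitary a b c in
    let open Ordinal _<_ in
    (δ : O) (s t t' : Tree) → IsTerm s → IsTerm t → IsTerm t' →
    P δ → s ↠[ δ ] t → t ⟶ t' →
    Σ Tree (λ s' → IsTerm s' × (s ⟶* s') × (s' ↠[ δ ] t'))
theorem3p15 a b c _<_ sto _ δ s t t' is it it' Pδ s↠t r =
  s , is , Infinitary.ε ≈-refl , ↠-⟶-trans Pδ is it it' s↠t r
  where open Reductions a b c _<_ (IsStrictTotalOrder.trans sto)
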